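{- Let $n\ge 1$. The maximal simplices of the clique complex $K_n$ of the partition graph $G_n$ are exactly: (1) all full star-simplices $\Sigma^{\mathrm{star}}_{\max}(\lambda,c)$ with $|A_{\max}(\lambda,c)|\ge 2$ (where $\lambda$ is a partition of $n$ and $c$ a removable corner of $\lambda$); (2) all full top-simplices $\Sigma^{\mathrm{top}}_{\max}(\lambda,a)$ with $|C_{\max}(\lambda,a)|\ge 2$ (where $\lambda$ is a partition of $n$ and $a$ an addable corner of $\lambda$); (3) all edges $\{\lambda,\lambda(c\to a)\}$ (with $\lambda(c\to a)$ an admissible transfer) such that $|A_{\max}(\lambda,c)|=1$ and $|C_{\max}(\lambda,a)|=1$.
   Context: A partition of $n$ is a weakly decreasing sequence $\lambda=(\lambda_1\ge\cdots\ge\lambda_\ell>0)$ of positive integers with sum $n$, identified with its Ferrers diagram ($\lambda_i$ left-justified cells in row $i$); set $\lambda_{\ell+1}=0$. The partition graph $G_n$ has as vertices all partitions of $n$; two distinct partitions are adjacent if one is obtained from the other by removing one cell from a row, adding it to another row (possibly a new row of length $0$), and reordering the row lengths into weakly decreasing order. $K_n$ is the clique complex of $G_n$: its simplices are the finite nonempty cliques of $G_n$. A simplex is maximal if it is not properly contained in another simplex of $K_n$. A removable corner of $\lambda$ is the last cell of a row whose length is strictly greater than that of the next row; an addable corner is a position where a cell can be added so that the result is again a Ferrers diagram of a partition (row $\ell+1$ allowed). Write $r(\cdot)$ for the row number of a corner. For a removable corner $c$ and an addable corner $a$ of $\lambda$ with $r(c)\ne r(a)$, remove $c$ (decrease $\lambda_{r(c)}$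 by $1$), add a cell at $a$ (increase $\lambda_{r(a)}$ by $1$), and reorder row lengths. If the result is a partition of $n$ different from $\lambda$, the transfer is called admissible and the result is denoted $\lambda(c\to a)$. The neighbors of $\lambda$ in $G_n$ are exactly the partitions $\lambda(c\to a)$ for admissible transfers. For a removable corner $c$ of $\lambda$: $A_{\max}(\lambda,c):=\{a:\lambda(c\to a)\text{ is admissible}\}$ and the full star-simplex is $\Sigma^{\mathrm{star}}_{\max}(\lambda,c):=\{\lambda\}\cup\{\lambda(c\to a):a\in A_{\max}(\lambda,c)\}$. For an addable corner $a$ of $\lambda$: $C_{\max}(\lambda,a):=\{c:\lambda(c\to a)\text{ is admissible}\}$ and the full top-simplex is $\Sigma^{\mathrm{top}}_{\max}(\lambda,a):=\{\lambda\}\cup\{\lambda(c\to a):c\in C_{\max}(\lambda,a)\}$. These are simplices of $K_n$.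
   Formalization: The formal statement assumes n ≥ 2 instead of n ≥ 1: for n = 1 the graph is the single vertex (1), which is a maximal simplex although there is no admissible transfer, so families (1)–(3) are empty and the claim fails. -}

module Defs where

open import Data.Nat.Base
  using (ℕ; zero; suc; pred; _+_; _≥_; _>_)
open import Data.Nat.Properties
  using (_≟_; _<?_; _≥?_; ≤-irrelevant; ≡-irrelevant; ≤-decTotalOrder;
         +-suc)
open import Data.Nat.ListAction using (sum)
open import Data.Nat.ListAction.Properties using (sum-↭)
open import Data.Fin.Base using (Fin; zero; suc; inject₁)
import Data.Fin.Properties as Fin
open import Data.List.Base using (List; []; _∷_; length; map; filter; allFin)
import Data.List.Properties as List
open import Data.List.Membership.Propositional using (_∈_)
open import Data.List.Relation.Binary.BagAndSetEquality using (_∼[_]_; set)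
open import Data.List.Relation.Binary.Permutation.Propositional using (↭-sym)
open import Data.List.Relation.Binary.Permutation.Propositional.Properties
  using (All-resp-↭)
open import Data.List.Relation.Binary.Subset.Propositional using (_⊆_)
open import Data.List.Relation.Unary.All as All using (All; []; _∷_)
open import Data.List.Relation.Unary.All.Properties using (all-filter)
open import Data.List.Relation.Unary.Linked as Linked using (Linked)
open import Data.Product.Base using (∃; ∃₂; _×_; _,_)
open import Data.Sum.Base using (_⊎_)
open import Data.Vec.Base using (Vec; []; _∷_; fromList; toList; lookup; updateAt; _∷ʳ_)
open import Relation.Binary.Definitions using (DecidableEquality)
import Relation.Binary.Properties.DecTotalOrder ≤-decTotalOrder as ≤
open import Relation.Binary.PropositionalEquality
  using (_≡_; _≢_; refl; sym; trans; cong)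
open import Relation.Nullary.Decidable using (Dec; map′; _×-dec_; ¬?)
open import Relation.Nullary.Negation using (¬_)

open import Data.List.Sort.Base ≤.≥-totalOrder using (module SortingAlgorithm)
open import Data.List.Sort.InsertionSort ≤.≥-decTotalOrder using (insertionSort)
open SortingAlgorithm insertionSort using (sort; sort-↭; sort-↗)

record Partition (n : ℕ) : Set where
  constructor mkPartition
  field
    parts      : List ℕ
    decreasing : Linked _≥_ parts
    positive   : All (_> 0) parts
    total      : sum parts ≡ n

  ℓ : ℕ
  ℓ = length parts

  -- The row lengths λ₁, …, λ_ℓ followed by λ_{ℓ+1} = 0.
  rows : Vec ℕ (suc ℓ)
  rows = fromList parts ∷ʳ 0

open Partition public

parts-injective : ∀ {n} {p q : Partition n} → parts p ≡ parts q → p ≡ q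
parts-injective {p = mkPartition _ d₁ z₁ t₁} {q = mkPartition _ d₂ z₂ t₂} refl
  with refl ← Linked.irrelevant ≤-irrelevant d₁ d₂
     | refl ← All.irrelevant ≤-irrelevant z₁ z₂
     | refl ← ≡-irrelevant t₁ t₂ = refl

_≟ₚ_ : ∀ {n} → DecidableEquality (Partition n)
p ≟ₚ q = map′ parts-injective (cong parts) (List.≡-dec _≟_ (parts p) (parts q))

-- Empty rows are dropped and the others sorted into weakly decreasing order.
reorder : List ℕ → List ℕ
reorder xs = sort (filter (0 <?_) xs)

sum-reorder : ∀ xs → sum (reorder xs) ≡ sum xs
sum-reorder xs = trans (sum-↭ (sort-↭ (filter (0 <?_) xs))) (go xs)
  where
  go : ∀ ys → sum (filter (0 <?_) ys) ≡ sum ys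
  go []           = refl
  go (zero  ∷ ys) = go ys
  go (suc y ∷ ys) = cong (suc y +_) (go ys)

-- Row i exists, so it has index i : Fin ℓ; the receiving row j : Fin (ℓ + 1)
-- may be the new row of length 0.
move : ∀ {n} (p : Partition n) → Fin (ℓ p) → Fin (suc (ℓ p)) → List ℕ
move p i j = toList (updateAt (updateAt (rows p) (inject₁ i) pred) j suc)

private
  sum-suc : ∀ {k} (xs : Vec ℕ k) j → sum (toList (updateAt xs j suc)) ≡ suc (sum (toList xs))
  sum-suc (x ∷ xs) zero    = refl
  sum-suc (x ∷ xs) (suc j) = trans (cong (x +_) (sum-suc xs j)) (+-suc x _)

  sum-pred : ∀ xs → All (_> 0) xs → (i : Fin (length xs)) →
             suc (sum (toList (updateAt (fromList xs ∷ʳ 0) (inject₁ i) pred))) ≡ sum xs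
  sum-pred (suc x ∷ xs) (_ ∷ _)  zero    = cong (λ s → suc (x + s)) (sum-rows xs)
    where
    sum-rows : ∀ ys → sum (toList (fromList ys ∷ʳ 0)) ≡ sum ys
    sum-rows []       = refl
    sum-rows (y ∷ ys) = cong (y +_) (sum-rows ys)
  sum-pred (x ∷ xs)     (_ ∷ zs) (suc i) =
    trans (sym (+-suc x _)) (cong (x +_) (sum-pred xs zs i))

sum-move : ∀ {n} (p : Partition n) i j → sum (move p i j) ≡ n
sum-move p i j =
  trans (sum-suc (updateAt (rows p) (inject₁ i) pred) j)
        (trans (sum-pred (parts p) (positive p) i) (total p))

transfer : ∀ {n} (p : Partition n) → Fin (ℓ p) → Fin (suc (ℓ p)) → Partition n
transfer p i j = mkPartition
  (reorder (move p i j))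
  (sort-↗ (filter (0 <?_) (move p i j)))
  (All-resp-↭ (↭-sym (sort-↭ _)) (all-filter (0 <?_) (move p i j)))
  (trans (sum-reorder (move p i j)) (sum-move p i j))

_⟶_ : ∀ {n} → Partition n → Partition n → Set
p ⟶ q = ∃₂ λ i j → inject₁ i ≢ j × transfer p i j ≡ q

Adjacent : ∀ {n} → Partition n → Partition n → Set
Adjacent p q = p ≢ q × (p ⟶ q ⊎ q ⟶ p)

-- A finite set of vertices is given by a list, considered up to _∼[ set ]_
-- (having the same members).
record Simplex {n} (S : List (Partition n)) : Set where
  field
    nonempty : ∃ λ p → p ∈ S
    clique   : ∀ {p q} → p ∈ S → q ∈ S → p ≢ q → Adjacent p q

_⊂_ : ∀ {n} → List (Partition n) → List (Partition n) → Set
S ⊂ T = S ⊆ T × ¬ (T ⊆ S)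

MaximalSimplex : ∀ {n} → List (Partition n) → Set
MaximalSimplex S = Simplex S × ¬ (∃ λ T → Simplex T × S ⊂ T)

-- Corners are identified with the (0-based) index of their row: each row ends
-- in at most one removable corner and admits at most one addable corner.

Removable : ∀ {n} (p : Partition n) → Fin (ℓ p) → Set
Removable p c = lookup (rows p) (inject₁ c) > lookup (rows p) (suc c)

Addable : ∀ {n} (p : Partition n) → Fin (suc (ℓ p)) → Set
Addable p a = Linked _≥_ (toList (updateAt (rows p) a suc))

Admissible : ∀ {n} (p : Partition n) → Fin (ℓ p) → Fin (suc (ℓ p)) → Set
Admissible p c a =
  Removable p c × Addable p a × inject₁ c ≢ a × transfer p c a ≢ p

admissible? : ∀ {n} (p : Partition n) c a → Dec (Admissible p c a)
admissible? p c a =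
  (lookup (rows p) (suc c) <? lookup (rows p) (inject₁ c))
  ×-dec Linked.linked? _≥?_ _
  ×-dec ¬? (inject₁ c Fin.≟ a)
  ×-dec ¬? (transfer p c a ≟ₚ p)

Amax : ∀ {n} (p : Partition n) → Fin (ℓ p) → List (Fin (suc (ℓ p)))
Amax p c = filter (admissible? p c) (allFin _)

Cmax : ∀ {n} (p : Partition n) → Fin (suc (ℓ p)) → List (Fin (ℓ p))
Cmax p a = filter (λ c → admissible? p c a) (allFin _)

Σstar : ∀ {n} (p : Partition n) → Fin (ℓ p) → List (Partition n)
Σstar p c = p ∷ map (transfer p c) (Amax p c)

Σtop : ∀ {n} (p : Partition n) → Fin (suc (ℓ p)) → List (Partition n)
Σtop p a = p ∷ map (λ c → transfer p c a) (Cmax p a)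

FullStar : ∀ {n} → List (Partition n) → Set
FullStar {n} S = ∃₂ λ (p : Partition n) c →
  Removable p c × length (Amax p c) ≥ 2 × S ∼[ set ] Σstar p c

FullTop : ∀ {n} → List (Partition n) → Set
FullTop {n} S = ∃₂ λ (p : Partition n) a →
  Addable p a × length (Cmax p a) ≥ 2 × S ∼[ set ] Σtop p a

MaximalEdge : ∀ {n} → List (Partition n) → Set
MaximalEdge {n} S = ∃ λ (p : Partition n) → ∃₂ λ c a →
  Admissible p c a × length (Amax p c) ≡ 1 × length (Cmax p a) ≡ 1 ×
  S ∼[ set ] (p ∷ transfer p c a ∷ [])

{-# OPTIONS --safe #-}
module Submission where

-- In terms of conjugate partitions a transfer moves one cell from a column x to
-- a column y without any reordering: λ' becomes λ' − e_x + e_y. So the vertices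
-- are the weakly decreasing sequences of sum n, and two of them are adjacent
-- exactly when they differ by a root e_y − e_x. The full star-simplices at λ are
-- the sets of all vertices λ' − e_x + e_z with x fixed, the full top-simplices
-- those with z fixed. If λ' − e_x + e_y and λ' − e_a + e_b are adjacent to each
-- other, then a = x or b = y; hence a clique containing λ and λ' − e_x + e_y lies
-- in the star of x or in the top of y, and a third vertex of a star or top
-- determines which.

open import Defs
open import Data.Nat.Base
  using (ℕ; zero; suc; pred; _+_; _≤_; _≥_; _<_; _>_; z≤n; s≤s; s≤s⁻¹)
open import Data.Nat.Properties
open import Data.Nat.ListAction using (sum)
open import Data.Nat.ListAction.Properties using (sum-↭)
open import Data.Nat.Tactic.RingSolver using (solve-∀)
open import Data.Fin.Base using (Fin; zero; suc; inject₁; toℕ; fromℕ<)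
open import Data.Fin.Properties using (toℕ-inject₁; toℕ-fromℕ<; toℕ-injective; toℕ<n)
open import Data.List.Base using (List; []; _∷_; map; filter; length; allFin)
open import Data.List.Membership.Propositional using (_∈_; find)
open import Data.List.Membership.Propositional.Properties
  using (∈-map⁺; ∈-map⁻; ∈-filter⁺; ∈-filter⁻; ∈-allFin)
open import Data.List.Relation.Binary.BagAndSetEquality using (_∼[_]_; set)
open import Data.List.Relation.Binary.Subset.Propositional using (_⊆_)
open import Data.List.Relation.Unary.All as All using (All; []; _∷_; all?)
open import Data.List.Relation.Unary.All.Properties using (¬All⇒Any¬; all-filter)
open import Data.List.Relation.Unary.Any using (here; there)
open import Data.List.Relation.Unary.AllPairs using (_∷_)
open import Data.List.Relation.Unary.Unique.Propositional using (Unique)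
open import Data.List.Relation.Unary.Unique.Propositional.Properties using (filter⁺; allFin⁺)
open import Data.List.Relation.Unary.Linked using (Linked; []; [-]; _∷_)
open import Data.List.Relation.Binary.Permutation.Propositional using (_↭_)
open import Data.List.Relation.Binary.Permutation.Propositional.Properties using (map⁺)
open import Data.Product.Base using (∃; ∃₂; _×_; _,_; proj₁; proj₂)
open import Data.Sum.Base using (_⊎_; inj₁; inj₂; fromInj₂; [_,_]′)
open import Data.Vec.Base using (Vec; []; _∷_; fromList; toList; lookup; updateAt; _∷ʳ_)
open import Data.Vec.Properties
  using (updateAt-updateAt; updateAt-id-local; lookup∘updateAt; lookup∘updateAt′)
open import Function.Base using (_∘_)
open import Function.Bundles using (_⇔_; mk⇔; Equivalence)
open import Relation.Binary.PropositionalEquality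
open import Relation.Unary using (Decidable)
open import Relation.Nullary.Decidable using (yes; no; decidable-stable)
open import Relation.Nullary.Negation using (¬_; contradiction)

import Relation.Binary.Properties.DecTotalOrder ≤-decTotalOrder as ≤
open import Data.List.Sort.Base ≤.≥-totalOrder using (module SortingAlgorithm)
open import Data.List.Sort.InsertionSort ≤.≥-decTotalOrder using (insertionSort)
open SortingAlgorithm insertionSort using (sort-↭)

-- Auxiliary facts on lists.

singleton : ∀ {A : Set} {x : A} {xs} → length xs ≡ 1 → x ∈ xs → xs ≡ x ∷ []
singleton {xs = _ ∷ []} _ (here refl) = refl

≡1⊎≥2 : ∀ {A : Set} {x : A} {xs} → x ∈ xs → length xs ≡ 1 ⊎ length xs ≥ 2
≡1⊎≥2 {xs = _ ∷ []}    _ = inj₁ refl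
≡1⊎≥2 {xs = _ ∷ _ ∷ _} _ = inj₂ (s≤s (s≤s z≤n))

filter-≥2 : ∀ {A : Set} {P : A → Set} (P? : Decidable P) {xs} →
            Unique xs → length (filter P? xs) ≥ 2 → ∃₂ λ x y → P x × P y × x ≢ y
filter-≥2 P? {xs} xs! ≥2 with filter P? xs | filter⁺ P? xs! | all-filter P? xs
filter-≥2 P? _ (s≤s ()) | _ ∷ []    | _               | _
filter-≥2 P? _ _        | _ ∷ _ ∷ _ | (x≢y ∷ _) ∷ _   | px ∷ py ∷ _ = _ , _ , px , py , x≢y

all⊎counterexample : ∀ {A : Set} {P : A → Set} → Decidable P → ∀ xs →
                     All P xs ⊎ ∃ λ x → x ∈ xs × ¬ P x
all⊎counterexample P? xs with all? P? xs
... | yes all = inj₁ all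
... | no ¬all = inj₂ (find (¬All⇒Any¬ P? xs ¬all))

-- Kronecker delta and the indicator of `k < x`.

δ : ℕ → ℕ → ℕ
δ zero    zero    = 1
δ zero    (suc _) = 0
δ (suc _) zero    = 0
δ (suc m) (suc n) = δ m n

δ-refl : ∀ n → δ n n ≡ 1
δ-refl zero    = refl
δ-refl (suc n) = δ-refl n

δ-≢ : ∀ {m n} → m ≢ n → δ m n ≡ 0
δ-≢ {zero}  {zero}  m≢n = contradiction refl m≢n
δ-≢ {zero}  {suc _} _   = refl
δ-≢ {suc _} {zero}  _   = refl
δ-≢ {suc m} {suc n} m≢n = δ-≢ (m≢n ∘ cong suc)

δ>0⇒≡ : ∀ {m n} → δ m n > 0 → m ≡ n
δ>0⇒≡ {m} {n} p with m ≟ n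
... | yes m≡n = m≡n
... | no  m≢n = contradiction (subst (_> 0) (δ-≢ m≢n) p) λ ()

-- The indicator of `k < x`: a row of length `x` meets exactly the columns below `x`.
χ : ℕ → ℕ → ℕ
χ k       zero    = 0
χ zero    (suc x) = 1
χ (suc k) (suc x) = χ k x

χ-suc : ∀ k x → χ k (suc x) ≡ δ x k + χ k x
χ-suc zero    zero    = refl
χ-suc (suc k) zero    = refl
χ-suc zero    (suc x) = refl
χ-suc (suc k) (suc x) = χ-suc k x

χ-< : ∀ {k x} → k < x → χ k x ≡ 1
χ-< {zero}  (s≤s _)   = refl
χ-< {suc k} (s≤s k<x) = χ-< k<x

χ-≥ : ∀ {k x} → x ≤ k → χ k x ≡ 0
χ-≥ z≤n       = refl
χ-≥ (s≤s x≤k) = χ-≥ x≤k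

χ≤1 : ∀ k x → χ k x ≤ 1
χ≤1 k       zero    = z≤n
χ≤1 zero    (suc x) = ≤-refl
χ≤1 (suc k) (suc x) = χ≤1 k x

χ-antitone : ∀ k x → χ (suc k) x ≤ χ k x
χ-antitone k       zero    = z≤n
χ-antitone zero    (suc x) = χ≤1 0 x
χ-antitone (suc k) (suc x) = χ-antitone k x

-- The conjugate partition, with columns counted from 0.
conj : List ℕ → ℕ → ℕ
conj xs k = sum (map (χ k) xs)

-- Effect of row operations on the conjugate.

swap : ∀ a b c → a + (b + c) ≡ b + (a + c)
swap = solve-∀

conj-↭ : ∀ {xs ys} → xs ↭ ys → ∀ k → conj xs k ≡ conj ys k
conj-↭ xs↭ys k = sum-↭ (map⁺ (χ k) xs↭ys)

conj-filter : ∀ xs k → conj (filter (0 <?_) xs) k ≡ conj xs k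
conj-filter []           k = refl
conj-filter (zero  ∷ xs) k = conj-filter xs k
conj-filter (suc x ∷ xs) k = cong (χ k (suc x) +_) (conj-filter xs k)

-- Column lengths depend neither on the order of the rows nor on empty rows, so the reordering after
-- a transfer leaves no trace.
conj-reorder : ∀ xs k → conj (reorder xs) k ≡ conj xs k
conj-reorder xs k = trans (conj-↭ (sort-↭ (filter (0 <?_) xs)) k) (conj-filter xs k)

conj-∷ʳ-0 : ∀ xs k → conj (toList (fromList xs ∷ʳ 0)) k ≡ conj xs k
conj-∷ʳ-0 []       k = refl
conj-∷ʳ-0 (x ∷ xs) k = cong (χ k x +_) (conj-∷ʳ-0 xs k)

-- With columns counted from 0, the cell appended to a row of length `x` lies in column `x`.
conj-suc : ∀ {m} (v : Vec ℕ m) j k →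
           conj (toList (updateAt v j suc)) k ≡ δ (lookup v j) k + conj (toList v) k
conj-suc (x ∷ v) zero    k =
  trans (cong (_+ conj (toList v) k) (χ-suc k x)) (+-assoc (δ x k) (χ k x) _)
conj-suc (x ∷ v) (suc j) k = trans (cong (χ k x +_) (conj-suc v j k))
  (swap (χ k x) (δ (lookup v j) k) (conj (toList v) k))

-- Putting the removed cell back reduces this to `conj-suc`. The additive form avoids truncated
-- subtraction.
conj-pred : ∀ {m} (v : Vec ℕ m) i → lookup v i > 0 → ∀ k →
            δ (pred (lookup v i)) k + conj (toList (updateAt v i pred)) k ≡ conj (toList v) k
conj-pred v i v[i]>0 k = begin
  δ (pred (lookup v i)) k + conj (toList v⁻) k
    ≡⟨ cong (λ y → δ y k + conj (toList v⁻) k) (lookup∘updateAt i v) ⟨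
  δ (lookup v⁻ i) k + conj (toList v⁻) k
    ≡⟨ conj-suc v⁻ i k ⟨
  conj (toList (updateAt v⁻ i suc)) k
    ≡⟨ cong (λ w → conj (toList w) k) (updateAt-updateAt i v) ⟩
  conj (toList (updateAt v i (λ x → suc (pred x)))) k
    ≡⟨ cong (λ w → conj (toList w) k) (updateAt-id-local i v (suc-pred′ v[i]>0)) ⟩
  conj (toList v) k ∎
  where
  open ≡-Reasoning
  v⁻ = updateAt v i pred
  suc-pred′ : ∀ {x} → x > 0 → suc (pred x) ≡ x
  suc-pred′ (s≤s _) = refl

conj-antitone : ∀ xs k → conj xs (suc k) ≤ conj xs k
conj-antitone []       k = z≤n
conj-antitone (x ∷ xs) k = +-mono-≤ (χ-antitone k x) (conj-antitone xs k)

conj≤length : ∀ xs k → conj xs k ≤ length xs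
conj≤length []       k = z≤n
conj≤length (x ∷ xs) k = +-mono-≤ (χ≤1 k x) (conj≤length xs k)

-- Row lengths, continued by 0, and their duality with columns.

part : List ℕ → ℕ → ℕ
part []       _       = 0
part (x ∷ xs) zero    = x
part (x ∷ xs) (suc i) = part xs i

lookup-∷ʳ-0 : ∀ xs (j : Fin (suc (length xs))) → lookup (fromList xs ∷ʳ 0) j ≡ part xs (toℕ j)
lookup-∷ʳ-0 []       zero    = refl
lookup-∷ʳ-0 (x ∷ xs) zero    = refl
lookup-∷ʳ-0 (x ∷ xs) (suc j) = lookup-∷ʳ-0 xs j

part-∷ʳ-0 : ∀ xs i → part (toList (fromList xs ∷ʳ 0)) i ≡ part xs i
part-∷ʳ-0 []       zero    = refl
part-∷ʳ-0 []       (suc i) = refl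
part-∷ʳ-0 (x ∷ xs) zero    = refl
part-∷ʳ-0 (x ∷ xs) (suc i) = part-∷ʳ-0 xs i

part-suc : ∀ {m} (v : Vec ℕ m) j i →
           part (toList (updateAt v j suc)) i ≡ δ (toℕ j) i + part (toList v) i
part-suc (x ∷ v) zero    zero    = refl
part-suc (x ∷ v) zero    (suc i) = refl
part-suc (x ∷ v) (suc j) zero    = refl
part-suc (x ∷ v) (suc j) (suc i) = part-suc v j i

part-antitone : ∀ {xs} → Linked _≥_ xs → ∀ i → part xs (suc i) ≤ part xs i
part-antitone []           i       = z≤n
part-antitone [-]          zero    = z≤n
part-antitone [-]          (suc i) = z≤n
part-antitone (x≥y ∷ _)    zero    = x≥y
part-antitone (_   ∷ xs↘)  (suc i) = part-antitone xs↘ i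

part-antitone⁻¹ : ∀ xs → (∀ i → part xs (suc i) ≤ part xs i) → Linked _≥_ xs
part-antitone⁻¹ []           _  = []
part-antitone⁻¹ (x ∷ [])     _  = [-]
part-antitone⁻¹ (x ∷ y ∷ xs) xs↘ = xs↘ 0 ∷ part-antitone⁻¹ (y ∷ xs) (xs↘ ∘ suc)

part≤head : ∀ {x xs} → Linked _≥_ (x ∷ xs) → ∀ i → part (x ∷ xs) i ≤ x
part≤head xs↘ zero    = ≤-refl
part≤head xs↘ (suc i) = ≤-trans (part-antitone xs↘ i) (part≤head xs↘ i)

part>0 : ∀ {xs} → All (_> 0) xs → ∀ {i} → i < length xs → part xs i > 0
part>0 (x>0 ∷ _)    {zero}  _         = x>0
part>0 (_   ∷ xs>0) {suc i} (s≤s i<l) = part>0 xs>0 i<l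

tail↘ : ∀ {x xs} → Linked _≥_ (x ∷ xs) → Linked _≥_ xs
tail↘ [-]       = []
tail↘ (_ ∷ xs↘) = xs↘

-- Both `i < conj xs k` and `k < part xs i` say that row `i` has a cell in column `k`. This is one
-- implication; `conj≤⇒part≤` is the converse in contrapositive form.
<conj⇒<part : ∀ {xs} → Linked _≥_ xs → ∀ {i k} → i < conj xs k → k < part xs i
<conj⇒<part {x ∷ xs} xs↘ {i} {k} i<c with k <? x | i
... | yes k<x | zero  = k<x
... | yes k<x | suc j =
  <conj⇒<part (tail↘ xs↘) (s≤s⁻¹ (subst (λ e → suc j < e + conj xs k) (χ-< k<x) i<c))
-- A first row that does not reach column `k` bounds all later rows.
... | no  k≮x | j     = contradiction
  (<-≤-trans (<conj⇒<part (tail↘ xs↘) (subst (λ e → j < e + conj xs k) (χ-≥ (≮⇒≥ k≮x)) i<c))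
             (part≤head xs↘ (suc j)))
  k≮x

conj≤⇒part≤ : ∀ {xs} → Linked _≥_ xs → ∀ {i k} → conj xs k ≤ i → part xs i ≤ k
conj≤⇒part≤ {[]}     _   _ = z≤n
conj≤⇒part≤ {x ∷ xs} xs↘ {i} {k} c≤i with k <? x
... | no  k≮x = ≤-trans (part≤head xs↘ i) (≮⇒≥ k≮x)
... | yes k<x with i | subst (λ e → e + conj xs k ≤ i) (χ-< k<x) c≤i
...   | suc j | s≤s c≤j = conj≤⇒part≤ (tail↘ xs↘) c≤j

<part⇒<conj : ∀ {xs} → Linked _≥_ xs → ∀ {i k} → k < part xs i → i < conj xs k
<part⇒<conj xs↘ k<p = ≰⇒> λ c≤i → <⇒≱ k<p (conj≤⇒part≤ xs↘ c≤i)

part≤⇒conj≤ : ∀ {xs} → Linked _≥_ xs → ∀ {i k} → part xs i ≤ k → conj xs k ≤ i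
part≤⇒conj≤ xs↘ p≤k = ≮⇒≥ λ i<c → <⇒≱ (<conj⇒<part xs↘ i<c) p≤k

-- Positive entries make each list end exactly where `part` becomes 0.
part-injective : ∀ {xs ys} → All (_> 0) xs → All (_> 0) ys →
                 (∀ i → part xs i ≡ part ys i) → xs ≡ ys
part-injective []          []          _  = refl
part-injective []          (y>0 ∷ _)   eq = contradiction (subst (_> 0) (sym (eq 0)) y>0) λ ()
part-injective (x>0 ∷ _)   []          eq = contradiction (subst (_> 0) (eq 0) x>0) λ ()
part-injective (_ ∷ xs>0)  (_ ∷ ys>0)  eq =
  cong₂ _∷_ (eq 0) (part-injective xs>0 ys>0 (eq ∘ suc))

module _ {n : ℕ} where

  open import Data.List.Membership.DecPropositional (_≟ₚ_ {n}) using (_∈?_)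
  open import Data.List.Relation.Binary.Subset.DecPropositional (_≟ₚ_ {n}) using (_⊆?_)

  -- Corners and their columns.

  conjₚ : Partition n → ℕ → ℕ
  conjₚ p = conj (parts p)

  conjₚ-injective : ∀ {p q} → (∀ k → conjₚ p k ≡ conjₚ q k) → p ≡ q
  conjₚ-injective {p} {q} eq = parts-injective (part-injective (positive p) (positive q)
    λ i → ≤-antisym (part-≤ p q (sym ∘ eq) i) (part-≤ q p eq i))
    where
    part-≤ : ∀ p q → (∀ k → conjₚ q k ≡ conjₚ p k) → ∀ i → part (parts p) i ≤ part (parts q) i
    -- The column compared is the one whose index is the length of row `i` of `q`.
    part-≤ p q eq i = conj≤⇒part≤ (decreasing p)
      (subst (_≤ i) (eq _) (part≤⇒conj≤ (decreasing q) ≤-refl))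

  -- The removed cell is the last one of its row, the added cell lies just after
  -- the last one.
  colᵣ : (p : Partition n) → Fin (ℓ p) → ℕ
  colᵣ p c = pred (part (parts p) (toℕ c))

  colₐ : (p : Partition n) → Fin (suc (ℓ p)) → ℕ
  colₐ p a = part (parts p) (toℕ a)

  removable⇒> : ∀ (p : Partition n) c → Removable p c →
                part (parts p) (toℕ c) > part (parts p) (suc (toℕ c))
  removable⇒> p c = subst₂ _>_
    (trans (lookup-∷ʳ-0 (parts p) (inject₁ c)) (cong (part (parts p)) (toℕ-inject₁ c)))
    (lookup-∷ʳ-0 (parts p) (suc c))

  >⇒removable : ∀ (p : Partition n) c → part (parts p) (toℕ c) > part (parts p) (suc (toℕ c)) →
                Removable p c
  >⇒removable p c = subst₂ _>_
    (sym (trans (lookup-∷ʳ-0 (parts p) (inject₁ c)) (cong (part (parts p)) (toℕ-inject₁ c))))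
    (sym (lookup-∷ʳ-0 (parts p) (suc c)))

  part-addable : ∀ (p : Partition n) a i →
                 part (toList (updateAt (rows p) a suc)) i ≡ δ (toℕ a) i + part (parts p) i
  part-addable p a i = trans (part-suc (rows p) a i) (cong (δ (toℕ a) i +_) (part-∷ʳ-0 (parts p) i))

  -- The lengthened row must not exceed the row above it; row 0 has none above, hence the form
  -- `suc i`.
  addable⇒> : ∀ (p : Partition n) a → Addable p a → ∀ {i} → toℕ a ≡ suc i →
              part (parts p) i > part (parts p) (suc i)
  addable⇒> p a add {i} a≡1+i = subst₂ _≤_
    (trans (part-addable p a (suc i))
      (cong (_+ part (parts p) (suc i)) (trans (cong (λ j → δ j (suc i)) a≡1+i) (δ-refl i))))
    (trans (part-addable p a i)
      (cong (_+ part (parts p) i) (δ-≢ λ a≡i → 1+n≢n (trans (sym a≡1+i) a≡i))))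
    (part-antitone add i)

  >⇒addable : ∀ (p : Partition n) a →
              (∀ {i} → toℕ a ≡ suc i → part (parts p) i > part (parts p) (suc i)) → Addable p a
  >⇒addable p a gt = part-antitone⁻¹ _ λ i →
    subst₂ _≤_ (sym (part-addable p a (suc i))) (sym (part-addable p a i)) (go i)
    where
    go : ∀ i → δ (toℕ a) (suc i) + part (parts p) (suc i) ≤ δ (toℕ a) i + part (parts p) i
    go i with toℕ a ≟ suc i
    ... | yes a≡1+i rewrite a≡1+i | δ-refl i = ≤-trans (gt refl) (m≤n+m _ (δ (suc i) i))
    ... | no  a≢1+i rewrite δ-≢ a≢1+i =
      ≤-trans (part-antitone (decreasing p) i) (m≤n+m _ (δ (toℕ a) i))

  part-c≡ : ∀ (p : Partition n) c → part (parts p) (toℕ c) ≡ suc (colᵣ p c)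
  part-c≡ p c with part (parts p) (toℕ c) | part>0 (positive p) (toℕ<n c)
  ... | suc _ | _ = refl

  -- A removable corner is the bottom cell of its column ...
  removable⇒conj : ∀ (p : Partition n) {c} → Removable p c → conjₚ p (colᵣ p c) ≡ suc (toℕ c)
  removable⇒conj p {c} rem = ≤-antisym
    (part≤⇒conj≤ (decreasing p) (s≤s⁻¹
      (subst (part (parts p) (suc (toℕ c)) <_) (part-c≡ p c) (removable⇒> p c rem))))
    (<part⇒<conj (decreasing p) (≤-reflexive (sym (part-c≡ p c))))

  -- ... and an addable one is the first free cell of its column.
  addable⇒conj : ∀ (p : Partition n) {a} → Addable p a → conjₚ p (colₐ p a) ≡ toℕ a
  addable⇒conj p {a} add = ≤-antisym (part≤⇒conj≤ (decreasing p) ≤-refl) (go (toℕ a) refl)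
    where
    go : ∀ i → toℕ a ≡ i → i ≤ conjₚ p (colₐ p a)
    go zero    _     = z≤n
    go (suc i) a≡1+i = <part⇒<conj (decreasing p)
      (subst (λ j → part (parts p) j < part (parts p) i) (sym a≡1+i) (addable⇒> p a add a≡1+i))

  -- The length of the column gives back the row of the corner.
  colᵣ-injective : ∀ (p : Partition n) {c c′} → Removable p c → Removable p c′ →
                   colᵣ p c ≡ colᵣ p c′ → c ≡ c′
  colᵣ-injective p r r′ eq = toℕ-injective (suc-injective
    (trans (sym (removable⇒conj p r)) (trans (cong (conjₚ p) eq) (removable⇒conj p r′))))

  colₐ-injective : ∀ (p : Partition n) {a a′} → Addable p a → Addable p a′ →
                   colₐ p a ≡ colₐ p a′ → a ≡ a′
  colₐ-injective p r r′ eq = toℕ-injective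
    (trans (sym (addable⇒conj p r)) (trans (cong (conjₚ p) eq) (addable⇒conj p r′)))

  -- Calculus of steps.

  -- In the conjugate of q one cell has gone from column x to column y.
  record Step (x y : ℕ) (p q : Partition n) : Set where
    constructor step
    field
      balance : ∀ k → δ x k + conjₚ q k ≡ δ y k + conjₚ p k

  open Step public

  -- Any column `x` serves, so `p` lies in all of its own stars and tops.
  step-refl : ∀ {x p} → Step x x p p
  step-refl = step λ _ → refl

  step-sym : ∀ {x y p q} → Step x y p q → Step y x q p
  step-sym s = step λ k → sym (balance s k)

  step-unique : ∀ {x y p q q′} → Step x y p q → Step x y p q′ → q ≡ q′
  step-unique {x} s s′ = conjₚ-injective λ k →
    +-cancelˡ-≡ (δ x k) _ _ (trans (balance s k) (sym (balance s′ k)))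

  step-≢ : ∀ {x y p q} → Step x y p q → p ≢ q → x ≢ y
  step-≢ s p≢q refl = p≢q (step-unique step-refl s)

  -- The common -e_x cancels: (e_z - e_x) - (e_y - e_x) = e_z - e_y. This makes stars cliques.
  step-star : ∀ {x y z p q r} → Step x y p q → Step x z p r → Step y z q r
  step-star {x} {y} {z} {p} {q} {r} s t = step λ k → +-cancelˡ-≡ (δ x k) _ _ (begin
    δ x k + (δ y k + conjₚ r k) ≡⟨ swap (δ x k) (δ y k) _ ⟩
    δ y k + (δ x k + conjₚ r k) ≡⟨ cong (δ y k +_) (balance t k) ⟩
    δ y k + (δ z k + conjₚ p k) ≡⟨ swap (δ y k) (δ z k) _ ⟩
    δ z k + (δ y k + conjₚ p k) ≡⟨ cong (δ z k +_) (balance s k) ⟨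
    δ z k + (δ x k + conjₚ q k) ≡⟨ swap (δ z k) (δ x k) _ ⟩
    δ x k + (δ z k + conjₚ q k) ∎)
    where open ≡-Reasoning

  -- Here the common e_y cancels, which makes tops cliques.
  step-top : ∀ {x w y p q r} → Step x y p q → Step w y p r → Step w x q r
  step-top s t = step λ k → trans (balance t k) (sym (balance s k))

  -- Steps, transfers and adjacency.

  transfer-step : ∀ (p : Partition n) {i j} → inject₁ i ≢ j → Step (colᵣ p i) (colₐ p j) p (transfer p i j)
  transfer-step p {i} {j} i≢j = step λ k → begin
    δ (colᵣ p i) k + conj (reorder (move p i j)) k
      ≡⟨ cong (δ (colᵣ p i) k +_) (conj-reorder (move p i j) k) ⟩
    δ (colᵣ p i) k + conj (move p i j) k
      ≡⟨ cong (δ (colᵣ p i) k +_) (conj-suc v j k) ⟩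
    δ (colᵣ p i) k + (δ (lookup v j) k + conj (toList v) k)
      -- Since `inject₁ i ≢ j`, row `j` still has its old length after the removal.
      ≡⟨ cong₂ (λ x y → δ (pred x) k + (δ y k + conj (toList v) k)) (sym lookup-i)
           (trans (lookup∘updateAt′ j (inject₁ i) (i≢j ∘ sym) (rows p)) (lookup-∷ʳ-0 (parts p) j)) ⟩
    δ (pred (lookup (rows p) (inject₁ i))) k + (δ (colₐ p j) k + conj (toList v) k)
      ≡⟨ swap (δ (pred (lookup (rows p) (inject₁ i))) k) (δ (colₐ p j) k) _ ⟩
    δ (colₐ p j) k + (δ (pred (lookup (rows p) (inject₁ i))) k + conj (toList v) k)
      ≡⟨ cong (δ (colₐ p j) k +_) (conj-pred (rows p) (inject₁ i)
           (subst (_> 0) (sym lookup-i) (part>0 (positive p) (toℕ<n i))) k) ⟩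
    δ (colₐ p j) k + conj (toList (rows p)) k
      ≡⟨ cong (δ (colₐ p j) k +_) (conj-∷ʳ-0 (parts p) k) ⟩
    δ (colₐ p j) k + conjₚ p k ∎
    where
    open ≡-Reasoning
    v = updateAt (rows p) (inject₁ i) pred
    lookup-i : lookup (rows p) (inject₁ i) ≡ part (parts p) (toℕ i)
    lookup-i = trans (lookup-∷ʳ-0 (parts p) (inject₁ i)) (cong (part (parts p)) (toℕ-inject₁ i))

  -- The corners are read off from the columns: the bottom cell of column `x` of `p` is in row
  -- `g x`, the first free cell of column `y` in row `f y`. Because the conjugate of `q` is weakly
  -- decreasing too, these rows have lengths `suc x` and `y`.
  step⇒transfer : ∀ {x y p q} → Step x y p q → p ≢ q →
                  ∃₂ λ c a → Admissible p c a × transfer p c a ≡ q × colᵣ p c ≡ x × colₐ p a ≡ y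
  step⇒transfer {x} {y} {p} {q} s p≢q =
    c , a , (rem , add , c≢a , λ t≡p → p≢q (trans (sym t≡p) t≡q)) , t≡q , cong pred row-c , row-a
    where
    x≢y = step-≢ s p≢q
    f = conjₚ p
    g = conjₚ q
    at-x : suc (g x) ≡ f x
    at-x = subst₂ (λ d e → d + g x ≡ e + f x) (δ-refl x) (δ-≢ (x≢y ∘ sym)) (balance s x)
    at-y : g y ≡ suc (f y)
    at-y = subst₂ (λ d e → d + g y ≡ e + f y) (δ-≢ x≢y) (δ-refl y) (balance s y)
    f≤g : ∀ {k} → x ≢ k → f k ≤ g k
    f≤g {k} x≢k = ≤-trans (m≤n+m (f k) (δ y k))
      (≤-reflexive (trans (sym (balance s k)) (cong (_+ g k) (δ-≢ x≢k))))
    g≤f : ∀ {k} → y ≢ k → g k ≤ f k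
    g≤f {k} y≢k = ≤-trans (m≤n+m (g k) (δ x k))
      (≤-reflexive (trans (balance s k) (cong (_+ f k) (δ-≢ y≢k))))
    c<ℓ : g x < ℓ p
    c<ℓ = ≤-trans (≤-reflexive at-x) (conj≤length (parts p) x)
    a<1+ℓ : f y < suc (ℓ p)
    a<1+ℓ = s≤s (conj≤length (parts p) y)
    c = fromℕ< c<ℓ
    a = fromℕ< a<1+ℓ
    c≡ : toℕ c ≡ g x
    c≡ = toℕ-fromℕ< c<ℓ
    a≡ : toℕ a ≡ f y
    a≡ = toℕ-fromℕ< a<1+ℓ
    row-c : part (parts p) (toℕ c) ≡ suc x
    -- Column `suc x` of `p` is at most as long as in `q`, hence at most `g x`.
    row-c = ≤-antisym
      (conj≤⇒part≤ (decreasing p) (≤-trans (f≤g (1+n≢n ∘ sym))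
        (≤-trans (conj-antitone (parts q) x) (≤-reflexive (sym c≡)))))
      (<conj⇒<part (decreasing p) (≤-reflexive (trans (cong suc c≡) at-x)))
    row-a : part (parts p) (toℕ a) ≡ y
    row-a = ≤-antisym (conj≤⇒part≤ (decreasing p) (≤-reflexive (sym a≡))) (y≤ y refl)
      where
      y≤ : ∀ k → k ≡ y → k ≤ part (parts p) (toℕ a)
      y≤ zero    _    = z≤n
      -- In `q` column `k` is at least as long as column `y`, which has gained a cell.
      y≤ (suc k) refl = <conj⇒<part (decreasing p) (≤-trans (≤-reflexive (trans (cong suc a≡) (sym at-y)))
        (≤-trans (conj-antitone (parts q) k) (g≤f 1+n≢n)))
    rem : Removable p c
    rem = >⇒removable p c (≤-trans
      (s≤s (conj≤⇒part≤ (decreasing p) (≤-reflexive (trans (sym at-x) (cong suc (sym c≡))))))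
      (≤-reflexive (sym row-c)))
    add : Addable p a
    add = >⇒addable p a λ {i} a≡1+i → subst (_< part (parts p) i)
      (trans (sym row-a) (cong (part (parts p)) a≡1+i))
      (<conj⇒<part (decreasing p) (≤-reflexive (trans (sym a≡1+i) a≡)))
    c≢a : inject₁ c ≢ a
    -- A common row would give `y ≡ suc x`, and then column `suc x` of `q` would be longer than
    -- column `x`.
    c≢a eq = 1+n≰n (subst₂ _≤_ at-y fy≡ (≤-trans (≤-reflexive (cong g y≡1+x)) (conj-antitone (parts q) x)))
      where
      tc≡ta : toℕ c ≡ toℕ a
      tc≡ta = trans (sym (toℕ-inject₁ c)) (cong toℕ eq)
      y≡1+x : y ≡ suc x
      y≡1+x = trans (sym row-a) (trans (cong (part (parts p)) (sym tc≡ta)) row-c)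
      fy≡ : g x ≡ f y
      fy≡ = trans (sym c≡) (trans tc≡ta a≡)
    t≡q : transfer p c a ≡ q
    t≡q = step-unique (transfer-step p c≢a)
      (subst₂ (λ x y → Step x y p q) (cong pred (sym row-c)) (sym row-a) s)

  adjacent⇒step : ∀ {p q} → Adjacent p q → ∃₂ λ x y → Step x y p q
  adjacent⇒step {p} (_ , inj₁ (i , j , i≢j , refl)) = _ , _ , transfer-step p i≢j
  adjacent⇒step {p} {q} (_ , inj₂ (i , j , i≢j , refl)) =
    _ , _ , step-sym (transfer-step q i≢j)

  step⇒adjacent : ∀ {x y p q} → Step x y p q → p ≢ q → Adjacent p q
  step⇒adjacent s p≢q with c , a , (_ , _ , c≢a , _) , t≡q , _ ← step⇒transfer s p≢q =
    p≢q , inj₁ (c , a , c≢a , t≡q)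

  step-≢⁻¹ : ∀ {x y p q} → Step x y p q → x ≢ y → p ≢ q
  step-≢⁻¹ {x} {y} s x≢y refl = x≢y (sym (δ>0⇒≡ (≤-reflexive (sym δyx≡1))))
    where
    δyx≡1 : δ y x ≡ 1
    δyx≡1 = trans (sym (+-cancelʳ-≡ _ (δ x x) (δ y x) (balance s x))) (δ-refl x)

  -- Column `y′` has grown by one cell, and the first step lets only column `y` grow.
  step-to-unique : ∀ {x y x′ y′ p q} → Step x y p q → Step x′ y′ p q → p ≢ q → y ≡ y′
  step-to-unique {x} {y} {x′} {y′} {p} {q} s s′ p≢q = δ>0⇒≡ (≤-trans (m≤n+m 1 (δ x y′))
    (≤-reflexive (+-cancelʳ-≡ (conjₚ p y′) _ _ (begin
      δ x y′ + 1 + conjₚ p y′   ≡⟨ +-assoc (δ x y′) 1 _ ⟩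
      δ x y′ + suc (conjₚ p y′) ≡⟨ cong (δ x y′ +_) q≡1+p ⟨
      δ x y′ + conjₚ q y′       ≡⟨ balance s y′ ⟩
      δ y y′ + conjₚ p y′       ∎))))
    where
    open ≡-Reasoning
    q≡1+p : conjₚ q y′ ≡ suc (conjₚ p y′)
    q≡1+p = subst₂ (λ d e → d + conjₚ q y′ ≡ e + conjₚ p y′)
      (δ-≢ (step-≢ s′ p≢q)) (δ-refl y′) (balance s′ y′)

  -- Otherwise the terms of e_b + e_x − e_a − e_y would not cancel, whereas the
  -- conjugates of q and r differ by e_d − e_c.
  step-triangle : ∀ {x y a b c d p q r} → Step x y p q → p ≢ q → Step a b p r → p ≢ r →
                  Step c d q r → a ≡ x ⊎ b ≡ y
  step-triangle {x} {y} {a} {b} {c} {d} {p} {q} {r} s p≢q t p≢r u with a ≟ x | b ≟ y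
  ... | yes a≡x | _       = inj₁ a≡x
  ... | no  _   | yes b≡y = inj₂ b≡y
  ... | no  a≢x | no  b≢y = contradiction 2≤1 λ { (s≤s ()) }
    where
    x≢y = step-≢ s p≢q
    a≢b = step-≢ t p≢r
    rearrange : ∀ a b c d e f → (a + b) + ((c + d) + (e + f)) ≡ (a + (c + e)) + (b + d + f)
    rearrange = solve-∀
    rearrange′ : ∀ a b c d e f → (a + b) + ((c + d) + (e + f)) ≡ (a + (c + e)) + (f + d + b)
    rearrange′ = solve-∀
    -- The three balances are added and the conjugates cancelled.
    sum≡ : ∀ k → δ d k + (δ y k + δ a k) ≡ δ c k + (δ x k + δ b k)
    sum≡ k = +-cancelʳ-≡ (conjₚ q k + conjₚ p k + conjₚ r k) _ _ (begin
      (δ d k + (δ y k + δ a k)) + (conjₚ q k + conjₚ p k + conjₚ r k)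
        ≡⟨ rearrange (δ d k) (conjₚ q k) (δ y k) (conjₚ p k) (δ a k) (conjₚ r k) ⟨
      (δ d k + conjₚ q k) + ((δ y k + conjₚ p k) + (δ a k + conjₚ r k))
        ≡⟨ cong₂ _+_ (sym (balance u k)) (cong₂ _+_ (sym (balance s k)) (balance t k)) ⟩
      (δ c k + conjₚ r k) + ((δ x k + conjₚ q k) + (δ b k + conjₚ p k))
        ≡⟨ rearrange′ (δ c k) (conjₚ r k) (δ x k) (conjₚ q k) (δ b k) (conjₚ p k) ⟩
      (δ c k + (δ x k + δ b k)) + (conjₚ p k + conjₚ q k + conjₚ r k)
        ≡⟨ cong (λ z → (δ c k + (δ x k + δ b k)) + (z + conjₚ r k)) (+-comm (conjₚ p k) (conjₚ q k)) ⟩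
      (δ c k + (δ x k + δ b k)) + (conjₚ q k + conjₚ p k + conjₚ r k) ∎)
      where open ≡-Reasoning
    δd≡ : ∀ {k} → y ≢ k → a ≢ k → δ d k ≡ δ c k + (δ x k + δ b k)
    δd≡ {k} y≢k a≢k = trans (sym (+-identityʳ (δ d k)))
      (trans (cong₂ (λ e e′ → δ d k + (e + e′)) (sym (δ-≢ y≢k)) (sym (δ-≢ a≢k))) (sum≡ k))
    -- In columns `b` and `x` the terms of `y` and `a` vanish, so both columns must be `d`. They
    -- coincide, and there the right side is at least 2.
    at-b = δd≡ (b≢y ∘ sym) a≢b
    at-x = δd≡ (x≢y ∘ sym) a≢x
    d≡b : d ≡ b
    d≡b = δ>0⇒≡ (≤-trans (≤-trans (≤-reflexive (sym (δ-refl b))) (m≤n+m _ (δ x b)))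
            (≤-trans (m≤n+m _ (δ c b)) (≤-reflexive (sym at-b))))
    d≡x : d ≡ x
    d≡x = δ>0⇒≡ (≤-trans (≤-trans (≤-reflexive (sym (δ-refl x))) (m≤m+n _ (δ b x)))
            (≤-trans (m≤n+m _ (δ c x)) (≤-reflexive (sym at-x))))
    x≡b : x ≡ b
    x≡b = trans (sym d≡x) d≡b
    2≤1 : 2 ≤ 1
    2≤1 = begin
      1 + 1                   ≡⟨ cong₂ _+_ (sym (trans (cong (λ z → δ z b) x≡b) (δ-refl b))) (sym (δ-refl b)) ⟩
      δ x b + δ b b           ≤⟨ m≤n+m _ (δ c b) ⟩
      δ c b + (δ x b + δ b b) ≡⟨ at-b ⟨
      δ d b                   ≡⟨ trans (cong (λ z → δ z b) d≡b) (δ-refl b) ⟩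
      1                       ∎
      where open ≤-Reasoning

  -- Stars and tops described by columns.

  Star Top : ℕ → Partition n → Partition n → Set
  Star x p r = ∃ λ b → Step x b p r
  Top  y p r = ∃ λ a → Step a y p r

  -- A vertex other than `p` has gained its cell in only one column, so two different tops meet only
  -- in `p`, which is in the star.
  top∩top⊆star : ∀ {x y y′ p r} → y ≢ y′ → Star x p r ⊎ Top y p r → Star x p r ⊎ Top y′ p r → Star x p r
  top∩top⊆star _ (inj₁ r∈star) _ = r∈star
  top∩top⊆star _ (inj₂ _) (inj₁ r∈star) = r∈star
  top∩top⊆star {p = p} {r} y≢y′ (inj₂ (_ , s)) (inj₂ (_ , s′)) with p ≟ₚ r
  ... | yes refl = _ , step-refl
  ... | no  p≢r  = contradiction (step-to-unique s s′ p≢r) y≢y′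

  star∩star⊆top : ∀ {x x′ y p r} → x ≢ x′ → Star x p r ⊎ Top y p r → Star x′ p r ⊎ Top y p r → Top y p r
  star∩star⊆top _ (inj₂ r∈top) _ = r∈top
  star∩star⊆top _ (inj₁ _) (inj₂ r∈top) = r∈top
  star∩star⊆top {p = p} {r} x≢x′ (inj₁ (_ , s)) (inj₁ (_ , s′)) with p ≟ₚ r
  ... | yes refl = _ , step-refl
  -- Reversed steps exchange the losing and the gaining column.
  ... | no  p≢r  = contradiction (step-to-unique (step-sym s) (step-sym s′) (p≢r ∘ sym)) x≢x′

  -- A single row gives a cell to a new row; otherwise the second row gives one to the first. For
  -- `n = 1` the only vertex is isolated.
  neighbour : n ≥ 2 → (p : Partition n) → ∃ λ q → Adjacent p q
  neighbour n≥2 p@(mkPartition [] _ _ refl) = contradiction n≥2 λ ()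
  neighbour n≥2 p@(mkPartition (x ∷ []) _ _ refl) =
    _ , step⇒adjacent s (step-≢⁻¹ s λ x≡1 → contradiction n≥2 (small x x≡1))
    where
    s = transfer-step p {zero} {suc zero} λ ()
    small : ∀ x → pred x ≡ 0 → ¬ (x + 0 ≥ 2)
    small zero       _ ()
    small (suc zero) _ (s≤s ())
  neighbour n≥2 p@(mkPartition (x ∷ y ∷ _) (x≥y ∷ _) (_ ∷ s≤s _ ∷ _) _) =
    _ , step⇒adjacent s (step-≢⁻¹ s (<⇒≢ x≥y))
    where s = transfer-step p {suc zero} {zero} λ ()

  -- Membership in the full simplices.

  transfer∈Σstar : ∀ (p : Partition n) c a → Admissible p c a → transfer p c a ∈ Σstar p c
  transfer∈Σstar p c a adm =
    there (∈-map⁺ (transfer p c) (∈-filter⁺ (admissible? p c) (∈-allFin a) adm))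

  transfer∈Σtop : ∀ (p : Partition n) c a → Admissible p c a → transfer p c a ∈ Σtop p a
  transfer∈Σtop p c a adm =
    there (∈-map⁺ (λ c → transfer p c a) (∈-filter⁺ (λ c → admissible? p c a) (∈-allFin c) adm))

  ∈Σstar⁻ : ∀ (p : Partition n) c {r} → r ∈ Σstar p c → Star (colᵣ p c) p r
  ∈Σstar⁻ p c (here refl) = _ , step-refl
  ∈Σstar⁻ p c (there r∈)  =
    let a , a∈ , r≡ = ∈-map⁻ (transfer p c) r∈ in
    _ , subst (Step _ _ p) (sym r≡) (transfer-step p
          (proj₁ (proj₂ (proj₂ (proj₂ (∈-filter⁻ (admissible? p c) {xs = allFin _} a∈))))))

  ∈Σtop⁻ : ∀ (p : Partition n) a {r} → r ∈ Σtop p a → Top (colₐ p a) p r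
  ∈Σtop⁻ p a (here refl) = _ , step-refl
  ∈Σtop⁻ p a (there r∈)  =
    let c , c∈ , r≡ = ∈-map⁻ (λ c → transfer p c a) r∈ in
    _ , subst (Step _ _ p) (sym r≡) (transfer-step p
          (proj₁ (proj₂ (proj₂ (proj₂ (∈-filter⁻ (λ c → admissible? p c a) {xs = allFin _} c∈))))))

  -- The step yields a removable corner in the column of `c`, and a column has only one.
  star⇒≡⊎transfer : ∀ p c {r} → Removable p c → Star (colᵣ p c) p r →
                    p ≡ r ⊎ ∃ λ a → Admissible p c a × transfer p c a ≡ r
  star⇒≡⊎transfer p c {r} rem (_ , s) with p ≟ₚ r
  ... | yes p≡r = inj₁ p≡r
  ... | no  p≢r =
    let c′ , a , adm , t≡r , c′≡ , _ = step⇒transfer s p≢r in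
    inj₂ (a , subst (λ c → Admissible p c a × transfer p c a ≡ r)
                (colᵣ-injective p (proj₁ adm) rem c′≡) (adm , t≡r))

  top⇒≡⊎transfer : ∀ p a {r} → Addable p a → Top (colₐ p a) p r →
                   p ≡ r ⊎ ∃ λ c → Admissible p c a × transfer p c a ≡ r
  top⇒≡⊎transfer p a {r} add (_ , s) with p ≟ₚ r
  ... | yes p≡r = inj₁ p≡r
  ... | no  p≢r =
    let c , a′ , adm , t≡r , _ , a′≡ = step⇒transfer s p≢r in
    inj₂ (c , subst (λ a → Admissible p c a × transfer p c a ≡ r)
                (colₐ-injective p (proj₁ (proj₂ adm)) add a′≡) (adm , t≡r))

  ∈Σstar⁺ : ∀ (p : Partition n) c {r} → Removable p c → Star (colᵣ p c) p r → r ∈ Σstar p c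
  ∈Σstar⁺ p c rem r∈star =
    [ here ∘ sym , (λ (a , adm , t≡r) → subst (_∈ Σstar p c) t≡r (transfer∈Σstar p c a adm)) ]′
    (star⇒≡⊎transfer p c rem r∈star)

  ∈Σtop⁺ : ∀ (p : Partition n) a {r} → Addable p a → Top (colₐ p a) p r → r ∈ Σtop p a
  ∈Σtop⁺ p a add r∈top =
    [ here ∘ sym , (λ (c , adm , t≡r) → subst (_∈ Σtop p a) t≡r (transfer∈Σtop p c a adm)) ]′
    (top⇒≡⊎transfer p a add r∈top)

  Σstar-simplex : ∀ (p : Partition n) c → Simplex (Σstar p c)
  Σstar-simplex p c = record
    { nonempty = p , here refl
    ; clique   = λ q∈ r∈ → step⇒adjacent (step-star (proj₂ (∈Σstar⁻ p c q∈)) (proj₂ (∈Σstar⁻ p c r∈)))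
    }

  Σtop-simplex : ∀ (p : Partition n) a → Simplex (Σtop p a)
  Σtop-simplex p a = record
    { nonempty = p , here refl
    ; clique   = λ q∈ r∈ → step⇒adjacent (step-top (proj₂ (∈Σtop⁻ p a q∈)) (proj₂ (∈Σtop⁻ p a r∈)))
    }

  simplex-⊆ : ∀ {S T : List (Partition n)} {p} → Simplex T → S ⊆ T → p ∈ S → Simplex S
  simplex-⊆ T-simplex S⊆T p∈S = record
    { nonempty = _ , p∈S
    ; clique   = λ q∈ r∈ → Simplex.clique T-simplex (S⊆T q∈) (S⊆T r∈)
    }

  edge⊆Σstar : ∀ (p : Partition n) c a → Admissible p c a → (p ∷ transfer p c a ∷ []) ⊆ Σstar p c
  edge⊆Σstar p c a adm (here refl)         = here refl
  edge⊆Σstar p c a adm (there (here refl)) = transfer∈Σstar p c a adm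

  edge⊆Σtop : ∀ (p : Partition n) c a → Admissible p c a → (p ∷ transfer p c a ∷ []) ⊆ Σtop p a
  edge⊆Σtop p c a adm (here refl)         = here refl
  edge⊆Σtop p c a adm (there (here refl)) = transfer∈Σtop p c a adm

  Amax-≥2 : ∀ (p : Partition n) c → length (Amax p c) ≥ 2 →
            ∃₂ λ a a′ → Admissible p c a × Admissible p c a′ × a ≢ a′
  Amax-≥2 p c = filter-≥2 (admissible? p c) (allFin⁺ _)

  Cmax-≥2 : ∀ (p : Partition n) a → length (Cmax p a) ≥ 2 →
            ∃₂ λ c c′ → Admissible p c a × Admissible p c′ a × c ≢ c′
  Cmax-≥2 p a = filter-≥2 (λ c → admissible? p c a) (allFin⁺ _)

  -- Cliques through a given vertex.

  module _ {T : List (Partition n)} (T-simplex : Simplex T) {p} (p∈T : p ∈ T) where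

    related : ∀ {q r} → q ∈ T → r ∈ T → ∃₂ λ x y → Step x y q r
    related {q} {r} q∈T r∈T with q ≟ₚ r
    -- Equal vertices differ by a trivial step; column 0 is an arbitrary choice.
    ... | yes refl = 0 , 0 , step-refl
    ... | no  q≢r  = adjacent⇒step (Simplex.clique T-simplex q∈T r∈T q≢r)

    triangle : ∀ {x y a b q r} → q ∈ T → r ∈ T → Step x y p q → p ≢ q →
               Step a b p r → p ≢ r → a ≡ x ⊎ b ≡ y
    triangle q∈T r∈T s p≢q t p≢r = step-triangle s p≢q t p≢r (proj₂ (proj₂ (related q∈T r∈T)))

    star⊎top : ∀ {x y q r} → q ∈ T → r ∈ T → Step x y p q → p ≢ q → Star x p r ⊎ Top y p r
    star⊎top {r = r} q∈T r∈T s p≢q with p ≟ₚ r | related p∈T r∈T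
    ... | yes refl | _ = inj₁ (_ , step-refl)
    ... | no  p≢r  | _ , _ , t with triangle q∈T r∈T s p≢q t p≢r
    ...   | inj₁ refl = inj₁ (_ , t)
    ...   | inj₂ refl = inj₂ (_ , t)

    -- If `u` did not gain its cell in column `y`, the triangle with `r` would make `r` lose its
    -- cell in column `x`, putting it in the star.
    star⇒top : ∀ {x y r u} → r ∈ T → u ∈ T → Top y p r → ¬ Star x p r → Star x p u → Top y p u
    star⇒top {r = r} {u} r∈T u∈T (_ , t) r∉star (_ , s) with p ≟ₚ r | p ≟ₚ u
    ... | yes refl | _        = contradiction (_ , step-refl) r∉star
    ... | no  _    | yes refl = _ , step-refl
    ... | no  p≢r  | no  p≢u  with triangle r∈T u∈T t p≢r s p≢u
    ...   | inj₁ refl = contradiction (_ , t) r∉star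
    ...   | inj₂ refl = _ , s

    -- Either all of `T` is in the star, or a single vertex outside it forces all of `T` into the
    -- top.
    ⊆Σstar⊎⊆Σtop : ∀ c a → Admissible p c a → transfer p c a ∈ T → T ⊆ Σstar p c ⊎ T ⊆ Σtop p a
    ⊆Σstar⊎⊆Σtop c a (rem , add , c≢a , t≢p) t∈T =
      [ (λ all → inj₁ λ {_} → All.lookup all)
      , (λ (r , r∈T , r∉star) → inj₂ λ {_} → ⊆top r∈T (r∉star ∘ ∈Σstar⁺ p c rem))
      ]′ (all⊎counterexample (_∈? Σstar p c) T)
      where
      split : ∀ {r} → r ∈ T → Star (colᵣ p c) p r ⊎ Top (colₐ p a) p r
      split r∈T = star⊎top t∈T r∈T (transfer-step p c≢a) (t≢p ∘ sym)
      ⊆top : ∀ {r} → r ∈ T → ¬ Star (colᵣ p c) p r → T ⊆ Σtop p a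
      ⊆top r∈T r∉star u∈T = ∈Σtop⁺ p a add (fromInj₂
        (star⇒top r∈T u∈T (fromInj₂ (λ r∈star → contradiction r∈star r∉star) (split r∈T)) r∉star)
        (split u∈T))

    -- Two neighbours in the star have different gaining columns. A further vertex of `T` is in the
    -- star or in both of their tops, and the latter again puts it in the star.
    Σstar-maximal : ∀ c → Removable p c → length (Amax p c) ≥ 2 → Σstar p c ⊆ T → T ⊆ Σstar p c
    Σstar-maximal c rem ≥2 star⊆T r∈T = ∈Σstar⁺ p c rem (go (Amax-≥2 p c ≥2))
      where
      go : (∃₂ λ a a′ → Admissible p c a × Admissible p c a′ × a ≢ a′) → Star (colᵣ p c) p _
      go (a , a′ , adm@(_ , add , c≢a , t≢p) , adm′@(_ , add′ , c≢a′ , t′≢p) , a≢a′) =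
        top∩top⊆star (a≢a′ ∘ colₐ-injective p add add′)
          (star⊎top (star⊆T (transfer∈Σstar p c a adm)) r∈T (transfer-step p c≢a) (t≢p ∘ sym))
          (star⊎top (star⊆T (transfer∈Σstar p c a′ adm′)) r∈T (transfer-step p c≢a′) (t′≢p ∘ sym))

    Σtop-maximal : ∀ a → Addable p a → length (Cmax p a) ≥ 2 → Σtop p a ⊆ T → T ⊆ Σtop p a
    Σtop-maximal a add ≥2 top⊆T r∈T = ∈Σtop⁺ p a add (go (Cmax-≥2 p a ≥2))
      where
      go : (∃₂ λ c c′ → Admissible p c a × Admissible p c′ a × c ≢ c′) → Top (colₐ p a) p _
      go (c , c′ , adm@(rem , _ , c≢a , t≢p) , adm′@(rem′ , _ , c′≢a , t′≢p) , c≢c′) =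
        star∩star⊆top (c≢c′ ∘ colᵣ-injective p rem rem′)
          (star⊎top (top⊆T (transfer∈Σtop p c a adm)) r∈T (transfer-step p c≢a) (t≢p ∘ sym))
          (star⊎top (top⊆T (transfer∈Σtop p c′ a adm′)) r∈T (transfer-step p c′≢a) (t′≢p ∘ sym))

  -- The three families consist of maximal simplices.

  edge-simplex : ∀ (p : Partition n) c a → Admissible p c a → Simplex (p ∷ transfer p c a ∷ [])
  edge-simplex p c a adm = simplex-⊆ (Σstar-simplex p c) (edge⊆Σstar p c a adm) (here refl)

  Σstar≡edge : ∀ (p : Partition n) c a → Admissible p c a → length (Amax p c) ≡ 1 →
               Σstar p c ≡ p ∷ transfer p c a ∷ []
  Σstar≡edge p c a adm ≡1 =
    cong (λ as → p ∷ map (transfer p c) as) (singleton ≡1 (∈-filter⁺ (admissible? p c) (∈-allFin a) adm))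

  Σtop≡edge : ∀ (p : Partition n) c a → Admissible p c a → length (Cmax p a) ≡ 1 →
              Σtop p a ≡ p ∷ transfer p c a ∷ []
  Σtop≡edge p c a adm ≡1 =
    cong (λ cs → p ∷ map (λ c → transfer p c a) cs)
      (singleton ≡1 (∈-filter⁺ (λ c → admissible? p c a) (∈-allFin c) adm))

  -- Maximality depends only on the set of members, so one representative `S′` suffices.
  maximalSimplex : ∀ {S S′ : List (Partition n)} → Simplex S′ → (∀ {T} → Simplex T → S′ ⊆ T → T ⊆ S′) →
                   S ∼[ set ] S′ → MaximalSimplex S
  maximalSimplex S′-simplex maximal S∼S′ =
    simplex-⊆ S′-simplex to (from (proj₂ (Simplex.nonempty S′-simplex))) ,
    λ (T , T-simplex , S⊆T , T⊈S) → T⊈S (from ∘ maximal T-simplex (S⊆T ∘ from))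
    where
    to : ∀ {p} → _ → _
    to {p} = Equivalence.to (S∼S′ {p})
    from : ∀ {p} → _ → _
    from {p} = Equivalence.from (S∼S′ {p})

  fullStar⇒maximal : ∀ {S : List (Partition n)} → FullStar S → MaximalSimplex S
  fullStar⇒maximal (p , c , rem , ≥2 , S∼) =
    maximalSimplex (Σstar-simplex p c)
      (λ T-simplex star⊆T → Σstar-maximal T-simplex (star⊆T (here refl)) c rem ≥2 star⊆T) S∼

  fullTop⇒maximal : ∀ {S : List (Partition n)} → FullTop S → MaximalSimplex S
  fullTop⇒maximal (p , a , add , ≥2 , S∼) =
    maximalSimplex (Σtop-simplex p a)
      (λ T-simplex top⊆T → Σtop-maximal T-simplex (top⊆T (here refl)) a add ≥2 top⊆T) S∼

  -- Star and top both shrink to the edge, and every clique containing the edge lies in their union.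
  maximalEdge⇒maximal : ∀ {S : List (Partition n)} → MaximalEdge S → MaximalSimplex S
  maximalEdge⇒maximal (p , c , a , adm , A≡1 , C≡1 , S∼) =
    maximalSimplex (edge-simplex p c a adm) maximal S∼
    where
    maximal : ∀ {T} → Simplex T → (p ∷ transfer p c a ∷ []) ⊆ T → T ⊆ (p ∷ transfer p c a ∷ [])
    maximal T-simplex e⊆T {r} r∈T =
      [ subst (r ∈_) (Σstar≡edge p c a adm A≡1) ∘ ∈Σstar⁺ p c (proj₁ adm)
      , subst (r ∈_) (Σtop≡edge p c a adm C≡1) ∘ ∈Σtop⁺ p a (proj₁ (proj₂ adm))
      ]′ (star⊎top T-simplex (e⊆T (here refl)) (e⊆T (there (here refl))) r∈T
            (transfer-step p (proj₁ (proj₂ (proj₂ adm)))) (proj₂ (proj₂ (proj₂ adm)) ∘ sym))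

  -- Every maximal simplex belongs to one of the families.

  module _ {S : List (Partition n)} (S-maximal : MaximalSimplex S) where

    -- Maximality only refutes `¬ (T ⊆ S)`; decidability of inclusion removes the double negation.
    ⊆⇒∼ : ∀ {T} → Simplex T → S ⊆ T → S ∼[ set ] T
    ⊆⇒∼ {T} T-simplex S⊆T =
      mk⇔ S⊆T (decidable-stable (T ⊆? S) λ T⊈S → proj₂ S-maximal (T , T-simplex , S⊆T , T⊈S))

    -- If all members were `p`, then `S` would lie in an edge at `p` and, by maximality, contain its
    -- other end.
    maximal⇒notSingleton : n ≥ 2 → ∀ {p} → p ∈ S → ∃ λ q → q ∈ S × p ≢ q
    maximal⇒notSingleton n≥2 {p} p∈S with all? (p ≟ₚ_) S
    ... | no ¬all = find (¬All⇒Any¬ (p ≟ₚ_) S ¬all)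
    ... | yes all =
      let q , p~q@(p≢q , _) = neighbour n≥2 p
          _ , _ , s = adjacent⇒step p~q
          c , a , adm@(_ , _ , _ , t≢p) , _ = step⇒transfer s p≢q
          S∼edge = ⊆⇒∼ (edge-simplex p c a adm) (here ∘ sym ∘ All.lookup all)
      in transfer p c a , Equivalence.from S∼edge (there (here refl)) , t≢p ∘ sym

    module _ (p : Partition n) c a (adm : Admissible p c a) where

      private
        Fan = FullStar S ⊎ FullTop S ⊎ MaximalEdge S

        |A| : length (Amax p c) ≡ 1 ⊎ length (Amax p c) ≥ 2
        |A| = ≡1⊎≥2 (∈-filter⁺ (admissible? p c) (∈-allFin a) adm)

        |C| : length (Cmax p a) ≡ 1 ⊎ length (Cmax p a) ≥ 2
        |C| = ≡1⊎≥2 (∈-filter⁺ (λ c → admissible? p c a) (∈-allFin c) adm)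

        fullStar : length (Amax p c) ≥ 2 → S ⊆ Σstar p c → Fan
        fullStar A≥2 S⊆star = inj₁ (p , c , proj₁ adm , A≥2 , ⊆⇒∼ (Σstar-simplex p c) S⊆star)

        fullTop : length (Cmax p a) ≥ 2 → S ⊆ Σtop p a → Fan
        fullTop C≥2 S⊆top = inj₂ (inj₁ (p , a , proj₁ (proj₂ adm) , C≥2 , ⊆⇒∼ (Σtop-simplex p a) S⊆top))

        edge : length (Amax p c) ≡ 1 → length (Cmax p a) ≡ 1 → S ⊆ (p ∷ transfer p c a ∷ []) → Fan
        edge A≡1 C≡1 S⊆edge =
          inj₂ (inj₂ (p , c , a , adm , A≡1 , C≡1 , ⊆⇒∼ (edge-simplex p c a adm) S⊆edge))

      -- If `Amax` or `Cmax` has at least two elements, the edge lies in that full simplex, with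
      -- which `S` then agrees by maximality.
      ⊆edge⇒fan : S ⊆ (p ∷ transfer p c a ∷ []) → Fan
      ⊆edge⇒fan S⊆edge = [ A≡1⇒fan , (λ A≥2 → fullStar A≥2 (edge⊆Σstar p c a adm ∘ S⊆edge)) ]′ |A|
        where
        A≡1⇒fan : length (Amax p c) ≡ 1 → Fan
        A≡1⇒fan A≡1 =
          [ (λ C≡1 → edge A≡1 C≡1 S⊆edge)
          , (λ C≥2 → fullTop C≥2 (edge⊆Σtop p c a adm ∘ S⊆edge))
          ]′ |C|

      ⊆Σstar⇒fan : S ⊆ Σstar p c → Fan
      ⊆Σstar⇒fan S⊆star =
        [ (λ A≡1 → ⊆edge⇒fan λ {r} → subst (r ∈_) (Σstar≡edge p c a adm A≡1) ∘ S⊆star)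
        , (λ A≥2 → fullStar A≥2 S⊆star)
        ]′ |A|

      ⊆Σtop⇒fan : S ⊆ Σtop p a → Fan
      ⊆Σtop⇒fan S⊆top =
        [ (λ C≡1 → ⊆edge⇒fan λ {r} → subst (r ∈_) (Σtop≡edge p c a adm C≡1) ∘ S⊆top)
        , (λ C≥2 → fullTop C≥2 S⊆top)
        ]′ |C|

      ⊆Σstar⊎⊆Σtop⇒fan : S ⊆ Σstar p c ⊎ S ⊆ Σtop p a → Fan
      ⊆Σstar⊎⊆Σtop⇒fan (inj₁ S⊆star) = ⊆Σstar⇒fan S⊆star
      ⊆Σstar⊎⊆Σtop⇒fan (inj₂ S⊆top)  = ⊆Σtop⇒fan S⊆top

    maximal⇒fan : n ≥ 2 → FullStar S ⊎ FullTop S ⊎ MaximalEdge S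
    maximal⇒fan n≥2 =
      let S-simplex             = proj₁ S-maximal
          p , p∈S               = Simplex.nonempty S-simplex
          q , q∈S , p≢q         = maximal⇒notSingleton n≥2 p∈S
          _ , _ , s             = adjacent⇒step (Simplex.clique S-simplex p∈S q∈S p≢q)
          c , a , adm , t≡q , _ = step⇒transfer s p≢q
      in ⊆Σstar⊎⊆Σtop⇒fan p c a adm
           (⊆Σstar⊎⊆Σtop S-simplex p∈S c a adm (subst (_∈ S) (sym t≡q) q∈S))

corollary3p12 : (n : ℕ) → n ≥ 2 → (S : List (Partition n)) →
    MaximalSimplex S ⇔ (FullStar S ⊎ FullTop S ⊎ MaximalEdge S)
corollary3p12 n n≥2 S = mk⇔
  (λ S-maximal → maximal⇒fan S-maximal n≥2)
  [ fullStar⇒maximal , [ fullTop⇒maximal , maximalEdge⇒maximal ]′ ]′
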